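{- Assume $\mathsf{AD}^{\mathsf{L}}$. For every $A\subseteq\omega^\omega$, $A$ is selfcontractible if and only if $A$ is $\mathsf{L}$-nonselfdual.
   Context: Base theory: $\mathsf{ZF}+\mathsf{DC}(\mathbb{R})$. $\omega^\omega$ is the Baire space with the standard metric $d(x,y)=0$ if $x=y$ and $d(x,y)=2^{ -n}$ if $x\neq y$ and $n$ is least with $x(n)\neq y(n)$. A function $f:\omega^\omega\to\omega^\omega$ is a contraction if there is a constant $0\leq L<1$ with $d(f(x),f(y))\leq L\cdot d(x,y)$ for all $x,y$, and is nonexpansive if $d(f(x),f(y))\leq d(x,y)$ for all $x,y$. $\mathsf{L}$ is the set of nonexpansive functions. $A\leq_{\mathsf{L}}B$ iff $A=f^{ -1}(B)$ for some $f\in\mathsf{L}$. $A$ is $\mathsf{L}$-nonselfdual if $A\nleq_{\mathsf{L}}\omega^\omega\setminus A$. A set $A\subseteq\omega^\omega$ is selfcontractible if there is a contraction $f:\omega^\omega\to\omega^\omega$ with $f^{ -1}(A)=A$. Lipschitz game $G_{\mathsf{L}}(A,B)$ for $A,B\subseteq\omega^\omega$: players I and II alternately play natural numbers (I first), I producing $a\in\omega^\omega$ and II producing $b\in\omega^\omega$ after $\omega$ many rounds; II wins iff ($a\in A\iff b\in B$). The axiom $\mathsf{AD}^{\mathsf{L}}$ states that for all $A,B\subseteq\omega^\omega$ the game $G_{\mathsf{L}}(A,B)$ is determined (one of the two players has a winning strategy). -}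

module Defs where

open import Axiom.Extensionality.Propositional using (Extensionality)
open import Data.Empty using (⊥-elim)
open import Data.List.Base using (List; applyDownFrom)
open import Data.Nat.Base as ℕ using (ℕ; zero; suc)
import Data.Nat.Properties as ℕ
open import Data.Nat.Induction using (<-rec)
open import Data.Product using (∃; _×_; _,_; proj₁)
open import Data.Rational.Base using (ℚ; 0ℚ; 1ℚ; ½; _+_; _-_; _*_; _≤_; _<_; ∣_∣)
open import Data.Sum.Base using (_⊎_)
open import Function.Base using (const)
open import Function.Bundles using (_⇔_)
open import Level using (0ℓ)
import Relation.Binary.Definitions as Binary
open import Relation.Binary.PropositionalEquality
  using (_≡_; _≢_; refl; cong; cong₂)
open import Relation.Binary.PropositionalEquality.WithK using (≡-irrelevant)
open import Relation.Nullary using (¬_; Dec; yes; no; Irrelevant)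
open import Relation.Nullary.Decidable using (decidable-stable)
open import Relation.Unary using (Pred; ∁; _≐_; _⊢_)
import Relation.Unary as Unary

-- Excluded middle is assumed for propositions (types with at most one element)
-- only.  `Dec P` for every type P would be a global choice operator, whereas
-- determinacy axioms are meant to be used without choice.
LEM : Set₁
LEM = {P : Set} → Irrelevant P → Dec P

-- Mere existence: a Σ-type carries a witness, and a function into it is a choice
-- function.  Set-theoretic "there exists" and "or" are rendered with ∥_∥; in the
-- presence of LEM, double negation is propositional truncation.
∥_∥ : ∀ {ℓ} → Set ℓ → Set ℓ
∥ P ∥ = ¬ ¬ P

Baire : Set
Baire = ℕ → ℕ

-- A subset of Baire space is a proposition-valued predicate: an
-- A : Pred Baire 0ℓ together with Unary.Irrelevant A.

-- Dependent choice for ω^ω.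
DC-ℝ : Set₁
DC-ℝ = (R : Baire → Baire → Set) → Binary.Irrelevant R →
       (∀ x → ∥ (∃ λ y → R x y) ∥) →
       ∥ (∃ λ (s : ℕ → Baire) → ∀ n → R (s n) (s (suc n))) ∥

-- Real numbers are represented by Cauchy sequences of rationals; a rational q is
-- `const q`, and products are computed termwise.
IsCauchy : (ℕ → ℚ) → Set
IsCauchy u = ∀ ε → 0ℚ < ε →
  ∥ (∃ λ N → ∀ m n → N ℕ.≤ m → N ℕ.≤ n → ∣ u m - u n ∣ ≤ ε) ∥

infix 4 _≤ᴿ_ _<ᴿ_

_≤ᴿ_ : (ℕ → ℚ) → (ℕ → ℚ) → Set
u ≤ᴿ v = ∀ ε → 0ℚ < ε → ∥ (∃ λ N → ∀ n → N ℕ.≤ n → u n ≤ v n + ε) ∥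

_<ᴿ_ : (ℕ → ℚ) → (ℕ → ℚ) → Set
u <ᴿ v = ¬ (v ≤ᴿ u)

2^- : ℕ → ℚ
2^- zero    = 1ℚ
2^- (suc n) = ½ * 2^- n

FirstDifference : Baire → Baire → ℕ → Set
FirstDifference x y n = x n ≢ y n × (∀ m → m ℕ.< n → x m ≡ y m)

firstDifference-irrelevant : Extensionality 0ℓ 0ℓ → ∀ x y →
                             Irrelevant (∃ (FirstDifference x y))
firstDifference-irrelevant funext x y (m , m≢ , <m) (n , n≢ , <n)
  with ℕ.<-cmp m n
... | Binary.tri< m<n _ _ = ⊥-elim (m≢ (<n m m<n))
... | Binary.tri> _ _ n<m = ⊥-elim (n≢ (<m n n<m))
... | Binary.tri≈ _ refl _ = cong (m ,_) (cong₂ _,_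
  (funext λ e → ⊥-elim (m≢ e))
  (funext λ k → funext λ k<m → ℕ.≡-irrelevant (<m k k<m) (<n k k<m)))

firstDifference : Extensionality 0ℓ 0ℓ → LEM → ∀ x y → x ≢ y →
                  ∃ (FirstDifference x y)
firstDifference funext lem x y x≢y with lem (firstDifference-irrelevant funext x y)
... | yes found = found
... | no  none  = ⊥-elim (x≢y (funext (<-rec _ λ n <n →
  decidable-stable (x n ℕ.≟ y n) λ n≢ → none (n , n≢ , λ m m<n → <n m<n))))

module BaireSpace (funext : Extensionality 0ℓ 0ℓ) (lem : LEM) where

  d : Baire → Baire → ℚ
  d x y with lem {x ≡ y} ≡-irrelevant
  ... | yes _   = 0ℚ
  ... | no  x≢y = 2^- (proj₁ (firstDifference funext lem x y x≢y))

  IsContraction : (Baire → Baire) → Set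
  IsContraction f = ∥ (∃ λ (L : ℕ → ℚ) → IsCauchy L ×
    const 0ℚ ≤ᴿ L × L <ᴿ const 1ℚ ×
    (∀ x y → const (d (f x) (f y)) ≤ᴿ (λ n → L n * d x y))) ∥

  IsNonexpansive : (Baire → Baire) → Set
  IsNonexpansive f = ∀ x y → d (f x) (f y) ≤ d x y

  infix 4 _≤ᴸ_

  _≤ᴸ_ : Pred Baire 0ℓ → Pred Baire 0ℓ → Set
  A ≤ᴸ B = ∥ (∃ λ f → IsNonexpansive f × A ≐ (f ⊢ B)) ∥

  LNonselfdual : Pred Baire 0ℓ → Set
  LNonselfdual A = ¬ (A ≤ᴸ ∁ A)

  Selfcontractible : Pred Baire 0ℓ → Set
  Selfcontractible A = ∥ (∃ λ f → IsContraction f × (f ⊢ A) ≐ A) ∥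

-- The first n rounds (aᵢ , bᵢ) of a play, most recent round first.
rounds : Baire → Baire → ℕ → List (ℕ × ℕ)
rounds a b = applyDownFrom (λ i → a i , b i)

-- Player I sees the completed rounds; player II sees in addition I's move in the
-- current round.
StrategyI StrategyII : Set
StrategyI  = List (ℕ × ℕ) → ℕ
StrategyII = List (ℕ × ℕ) → ℕ → ℕ

FollowsI : StrategyI → Baire → Baire → Set
FollowsI σ a b = ∀ n → a n ≡ σ (rounds a b n)

FollowsII : StrategyII → Baire → Baire → Set
FollowsII τ a b = ∀ n → b n ≡ τ (rounds a b n) (a n)

IIWinsPlay : Pred Baire 0ℓ → Pred Baire 0ℓ → Baire → Baire → Set
IIWinsPlay A B a b = A a ⇔ B b

WinningI : Pred Baire 0ℓ → Pred Baire 0ℓ → StrategyI → Set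
WinningI A B σ = ∀ a b → FollowsI σ a b → ¬ IIWinsPlay A B a b

WinningII : Pred Baire 0ℓ → Pred Baire 0ℓ → StrategyII → Set
WinningII A B τ = ∀ a b → FollowsII τ a b → IIWinsPlay A B a b

Determined : Pred Baire 0ℓ → Pred Baire 0ℓ → Set
Determined A B = ∥ (∃ (WinningI A B) ⊎ ∃ (WinningII A B)) ∥

AD-L : Set₁
AD-L = (A B : Pred Baire 0ℓ) → Unary.Irrelevant A → Unary.Irrelevant B →
       Determined A B

{-# OPTIONS --safe #-}

-- (⇒) If f is a contraction with f⁻¹(A) = A and g is a nonexpansive reduction of
-- A to its complement, then f ∘ g is a contraction with (f ∘ g)⁻¹(A) = ∁ A, so
-- its Banach fixed point lies in A iff it does not.
-- (⇐) If A is L-nonselfdual, then II has no winning strategy in G_L(A, ∁ A), so I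
-- has one.  I's n-th move depends only on the first n moves of II, so the
-- strategy induces a map with Lipschitz constant ½, and it preserves membership
-- in A because II loses every play.
-- Distances are powers of 2, so L < 1 already forces Lipschitz constant ½; all
-- maps can therefore be handled through agreement of initial segments.
module Submission where

open import Axiom.Extensionality.Propositional using (Extensionality)
open import Data.List.Base using (List; []; _∷_)
open import Data.Nat.Base as ℕ using (ℕ; zero; suc; z≤n; s≤s)
import Data.Nat.Properties as ℕ
open import Data.Product using (∃; _×_; _,_)
open import Data.Rational.Base
  using (ℚ; 0ℚ; 1ℚ; ½; _+_; _*_; _≤_; _<_; ∣_∣; Positive; positive)
import Data.Rational.Properties as ℚ
open import Data.Sum.Base using (_⊎_; inj₁; inj₂; [_,_]′)
open import Function.Base using (const; _∘_)
open import Function.Bundles using (_⇔_; mk⇔; Equivalence)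
open import Level using (0ℓ)
open import Relation.Binary.PropositionalEquality
  using (_≡_; refl; sym; trans; cong; cong₂; subst; subst₂)
open import Relation.Binary.PropositionalEquality.WithK using (≡-irrelevant)
import Relation.Nullary as Nullary
open import Relation.Nullary using (¬_; yes; no; contradiction)
open import Relation.Nullary.Decidable using (decidable-stable; from-yes; from-no)
open import Relation.Unary using (Pred; Irrelevant; ∁)
open import Defs

-- Dyadic distances and the order of represented reals.

2^-positive : ∀ n → Positive (2^- n)
2^-positive zero    = _
2^-positive (suc n) = ℚ.pos*pos⇒pos ½ (2^- n) {{2^-positive n}}

2^-≤1 : ∀ n → 2^- n ≤ 1ℚ
2^-≤1 zero    = ℚ.≤-refl
2^-≤1 (suc n) = ℚ.≤-trans (ℚ.*-monoˡ-≤-nonNeg ½ (2^-≤1 n)) (from-yes (½ ℚ.≤? 1ℚ))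

2^-antitone : ∀ {m n} → m ℕ.≤ n → 2^- n ≤ 2^- m
2^-antitone {n = n} z≤n = 2^-≤1 n
2^-antitone (s≤s m≤n)   = ℚ.*-monoˡ-≤-nonNeg ½ (2^-antitone m≤n)

2^-suc< : ∀ n → 2^- (suc n) < 2^- n
2^-suc< n = subst (2^- (suc n) <_) (ℚ.*-identityˡ (2^- n))
  (ℚ.*-monoˡ-<-pos (2^- n) {{2^-positive n}} (from-yes (½ ℚ.<? 1ℚ)))

2^-cancel-≤ : ∀ {m n} → 2^- n ≤ 2^- m → m ℕ.≤ n
2^-cancel-≤ {m} {n} le = ℕ.≮⇒≥ λ n<m →
  ℚ.<-irrefl refl (ℚ.≤-<-trans (ℚ.≤-trans le (2^-antitone n<m)) (2^-suc< n))

-- Replacing γ by δ, instead of δ by γ, avoids products with a possibly negative u n.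
*-cancelʳ-≤ᴿ : ∀ (u : ℕ → ℚ) {γ δ} .{{_ : Positive δ}} → δ ≤ γ →
               const γ ≤ᴿ (λ n → u n * δ) → const 1ℚ ≤ᴿ u
*-cancelʳ-≤ᴿ u {γ} {δ} δ≤γ γ≤uδ ε 0<ε none =
  γ≤uδ (ε * δ) 0<εδ λ { (N , bound) → none (N , λ n N≤n →
    ℚ.*-cancelʳ-≤-pos δ (begin
      1ℚ * δ          ≡⟨ ℚ.*-identityˡ δ ⟩
      δ               ≤⟨ δ≤γ ⟩
      γ               ≤⟨ bound n N≤n ⟩
      u n * δ + ε * δ ≡⟨ ℚ.*-distribʳ-+ δ (u n) ε ⟨
      (u n + ε) * δ   ∎)) }
  where
  open ℚ.≤-Reasoning
  0<εδ : 0ℚ < ε * δ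
  0<εδ = ℚ.positive⁻¹ (ε * δ) {{ℚ.pos*pos⇒pos ε {{positive 0<ε}} δ}}

const-IsCauchy : ∀ q → IsCauchy (const q)
const-IsCauchy q ε 0<ε none = none (0 , λ _ _ _ _ →
  subst (λ r → ∣ r ∣ ≤ ε) (sym (ℚ.+-inverseʳ q)) (ℚ.<⇒≤ 0<ε))

const-≤ᴿ : ∀ {p q} → p ≤ q → const p ≤ᴿ const q
const-≤ᴿ {p} {q} p≤q ε 0<ε none = none (0 , λ _ _ →
  subst (_≤ q + ε) (ℚ.+-identityʳ p) (ℚ.+-mono-≤ p≤q (ℚ.<⇒≤ 0<ε)))

½<ᴿ1 : const ½ <ᴿ const 1ℚ
-- The tolerance ¼ refutes the inequality, as ½ + ¼ is still below 1.
½<ᴿ1 1≤½ = 1≤½ (½ * ½) (from-yes (0ℚ ℚ.<? ½ * ½)) λ { (N , bound) →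
  from-no (1ℚ ℚ.≤? ½ + ½ * ½) (bound N ℕ.≤-refl) }

-- Agreement of initial segments and fixed points.

Agree : ℕ → Baire → Baire → Set
Agree n x y = ∀ k → k ℕ.< n → x k ≡ y k

agree-snoc : ∀ {n x y} → Agree n x y → x n ≡ y n → Agree (suc n) x y
agree-snoc agree xn≡yn k k<1+n with ℕ.m<1+n⇒m<n∨m≡n k<1+n
... | inj₁ k<n  = agree k k<n
... | inj₂ refl = xn≡yn

-- Modulus k renders Lipschitz constant 2^- k.
HasModulus : ℕ → (Baire → Baire) → Set
HasModulus k f = ∀ {n x y} → Agree n x y → Agree (k ℕ.+ n) (f x) (f y)

module _ {h : Baire → Baire} (h-contracts : HasModulus 1 h) where

  private
    iterate : ℕ → Baire
    iterate zero    = const 0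
    iterate (suc n) = h (iterate n)

    iterate-step : ∀ n → Agree n (iterate n) (iterate (suc n))
    iterate-step zero    _ ()
    iterate-step (suc n) = h-contracts (iterate-step n)

    -- All iterates from `suc n` on share their value at `n`, so the diagonal reads settled values.
    limit : Baire
    limit n = iterate (suc n) n

    limit-agree : ∀ n → Agree n limit (iterate n)
    limit-agree zero    _ ()
    limit-agree (suc n) = agree-snoc
      (λ k k<n → trans (limit-agree n k k<n) (iterate-step n k k<n)) refl

  -- Modulus 1 carries the agreement of `limit` with `iterate n` below `n` one index further: at
  -- `n`, `h limit` takes the value `iterate (suc n) n`, which is `limit n`.
  banach : Extensionality 0ℓ 0ℓ → ∃ λ x → h x ≡ x
  banach funext = limit , funext λ n → h-contracts (limit-agree n) n ℕ.≤-refl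

-- From the metric to moduli and back.

module _ (funext : Extensionality 0ℓ 0ℓ) (lem : LEM) where

  open BaireSpace funext lem

  d-view : ∀ x y → (x ≡ y × d x y ≡ 0ℚ) ⊎
                   (∃ λ p → FirstDifference x y p × d x y ≡ 2^- p)
  d-view x y with lem {x ≡ y} ≡-irrelevant
  ... | yes x≡y = inj₁ (x≡y , refl)
  ... | no  x≢y = let p , fd = firstDifference funext lem x y x≢y in
                  inj₂ (p , fd , refl)

  d-self : ∀ x → d x x ≡ 0ℚ
  d-self x with d-view x x
  ... | inj₁ (_ , d≡0) = d≡0
  ... | inj₂ (_ , (xp≢xp , _) , _) = contradiction refl xp≢xp

  firstDifference-≥ : ∀ {n p x y} → FirstDifference x y p → Agree n x y → n ℕ.≤ p
  firstDifference-≥ (xp≢yp , _) agree = ℕ.≮⇒≥ λ p<n → xp≢yp (agree _ p<n)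

  agree⇒d≤ : ∀ {n x y} → Agree n x y → d x y ≤ 2^- n
  agree⇒d≤ {n} {x} {y} agree with d-view x y
  ... | inj₁ (_ , d≡0) = subst (_≤ 2^- n) (sym d≡0)
    (ℚ.<⇒≤ (ℚ.positive⁻¹ (2^- n) {{2^-positive n}}))
  ... | inj₂ (p , fd , d≡) = subst (_≤ 2^- n) (sym d≡)
    (2^-antitone (firstDifference-≥ fd agree))

  d≤⇒agree : ∀ {n x y} → d x y ≤ 2^- n → Agree n x y
  d≤⇒agree {n} {x} {y} d≤ with d-view x y
  ... | inj₁ (refl , _) = λ _ _ → refl
  ... | inj₂ (p , (_ , <p) , d≡) = λ k k<n →
    <p k (ℕ.<-≤-trans k<n (2^-cancel-≤ (subst (_≤ 2^- n) d≡ d≤)))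

  nonexpansive⇒modulus : ∀ {f} → IsNonexpansive f → HasModulus 0 f
  nonexpansive⇒modulus ne {x = x} {y} agree =
    d≤⇒agree (ℚ.≤-trans (ne x y) (agree⇒d≤ agree))

  modulus⇒nonexpansive : ∀ {f} → HasModulus 0 f → IsNonexpansive f
  modulus⇒nonexpansive {f} mod x y with d-view x y
  ... | inj₁ (refl , d≡0) = ℚ.≤-reflexive (trans (d-self (f x)) (sym d≡0))
  ... | inj₂ (p , (_ , <p) , d≡) =
    subst (d (f x) (f y) ≤_) (sym d≡) (agree⇒d≤ (mod <p))

  -- If `f x` and `f y` first differed at `m ≤ n`, then `x` and `y`, first differing at some
  -- `p ≥ n`, would give `2^- p ≤ 2^- m ≤ L * 2^- p`, hence `1 ≤ L`.
  contraction⇒modulus : ∀ {f} → IsContraction f → HasModulus 1 f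
  contraction⇒modulus {f} contraction {n} {x} {y} agree with d-view (f x) (f y)
  ... | inj₁ (fx≡fy , _) = λ k _ → cong (λ z → z k) fx≡fy
  ... | inj₂ (m , (≢m , <m) , dfxfy≡) = λ k k<1+n → <m k (ℕ.<-≤-trans k<1+n n<m)
    where
    n<m : n ℕ.< m
    -- Arguing by contradiction makes the goal empty, so the merely existing `L` can be used.
    n<m = ℕ.≰⇒> λ m≤n → contraction λ { (L , _ , _ , L<1 , bound) →
      case-d-xy L m≤n L<1 (bound x y) }
      where
      case-d-xy : ∀ L → m ℕ.≤ n → L <ᴿ const 1ℚ →
                  ¬ (const (d (f x) (f y)) ≤ᴿ (λ i → L i * d x y))
      case-d-xy L m≤n L<1 bound with d-view x y
      ... | inj₁ (refl , _) = ≢m refl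
      ... | inj₂ (p , fd , dxy≡) = L<1 (*-cancelʳ-≤ᴿ L {{2^-positive p}}
        (2^-antitone (ℕ.≤-trans m≤n (firstDifference-≥ fd agree)))
        (subst₂ (λ γ δ → const γ ≤ᴿ (λ i → L i * δ)) dfxfy≡ dxy≡ bound))

  modulus⇒contraction : ∀ {f} → HasModulus 1 f → IsContraction f
  modulus⇒contraction {f} mod none = none
    ( const ½ , const-IsCauchy ½ , const-≤ᴿ (from-yes (0ℚ ℚ.≤? ½)) , ½<ᴿ1
    , λ x y → const-≤ᴿ (halves x y))
    where
    halves : ∀ x y → d (f x) (f y) ≤ ½ * d x y
    halves x y with d-view x y
    ... | inj₁ (refl , d≡0) =
      ℚ.≤-reflexive (trans (d-self (f x)) (cong (½ *_) (sym d≡0)))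
    ... | inj₂ (p , (_ , <p) , d≡) =
      -- Agreement below `p` becomes agreement below `suc p`, and `2^- (suc p)` is `½ * 2^- p` by
      -- definition.
      subst (λ q → d (f x) (f y) ≤ ½ * q) (sym d≡) (agree⇒d≤ (mod <p))

-- Strategies as maps on Baire space.

module _ (τ : StrategyII) where

  private
    -- Recursion on the round builds moves and history together; stating the response through
    -- `rounds` would be circular.
    history : Baire → ℕ → List (ℕ × ℕ)
    history a zero    = []
    history a (suc n) = (a n , τ (history a n) (a n)) ∷ history a n

  responseII : Baire → Baire
  responseII a n = τ (history a n) (a n)

  private
    history≡rounds : ∀ a n → history a n ≡ rounds a (responseII a) n
    history≡rounds a zero    = refl
    history≡rounds a (suc n) = cong ((a n , responseII a n) ∷_) (history≡rounds a n)

    history-cong : ∀ {n a a′} → Agree n a a′ → history a n ≡ history a′ n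
    history-cong {zero}  agree = refl
    history-cong {suc n} agree = cong₂ (λ c h → (c , τ h c) ∷ h)
      (agree n ℕ.≤-refl) (history-cong λ k k<n → agree k (ℕ.m<n⇒m<1+n k<n))

  responseII-follows : ∀ a → FollowsII τ a (responseII a)
  responseII-follows a n = cong (λ h → τ h (a n)) (history≡rounds a n)

  -- II's move `k` also sees I's move `k`, so agreement is kept but not lengthened.
  responseII-modulus : HasModulus 0 responseII
  responseII-modulus agree k k<n =
    cong₂ τ (history-cong λ i i<k → agree i (ℕ.<-trans i<k k<n)) (agree k k<n)

module _ (σ : StrategyI) where

  private
    history : Baire → ℕ → List (ℕ × ℕ)
    history b zero    = []
    history b (suc n) = (σ (history b n) , b n) ∷ history b n

  responseI : Baire → Baire
  responseI b n = σ (history b n)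

  private
    history≡rounds : ∀ b n → history b n ≡ rounds (responseI b) b n
    history≡rounds b zero    = refl
    history≡rounds b (suc n) = cong ((responseI b n , b n) ∷_) (history≡rounds b n)

    history-cong : ∀ {n b b′} → Agree n b b′ → history b n ≡ history b′ n
    history-cong {zero}  agree = refl
    history-cong {suc n} agree = cong₂ (λ c h → (σ h , c) ∷ h)
      (agree n ℕ.≤-refl) (history-cong λ k k<n → agree k (ℕ.m<n⇒m<1+n k<n))

  responseI-follows : ∀ b → FollowsI σ (responseI b) b
  responseI-follows b n = cong σ (history≡rounds b n)

  responseI-modulus : HasModulus 1 responseI
  responseI-modulus agree k k<1+n = cong σ (history-cong λ i i<k →
    agree i (ℕ.<-≤-trans i<k (ℕ.m<1+n⇒m≤n k<1+n)))

-- The two implications.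

winningII⇒≤ᴸ : (funext : Extensionality 0ℓ 0ℓ) (lem : LEM) → ∀ {A B} τ → WinningII A B τ →
               BaireSpace._≤ᴸ_ funext lem A B
winningII⇒≤ᴸ funext lem τ win none = none
  ( responseII τ
  , modulus⇒nonexpansive funext lem (responseII-modulus τ)
  , (λ {a} → Equivalence.to (reduces a)) , (λ {a} → Equivalence.from (reduces a)))
  where reduces = λ a → win a (responseII τ a) (responseII-follows τ a)

-- Reads a play of the game for `A` and `∁ A` that II loses as preservation of membership in `A`.
-- Irrelevance lets `lem` decide both sides.
¬⇔¬⇒⇔ : LEM → {P Q : Set} → Nullary.Irrelevant P → Nullary.Irrelevant Q →
         ¬ (P ⇔ (¬ Q)) → P ⇔ Q
¬⇔¬⇒⇔ lem P-irr Q-irr differ = mk⇔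
  (λ p → decidable-stable (lem Q-irr) λ ¬q → differ (mk⇔ (λ _ → ¬q) (λ _ → p)))
  (λ q → decidable-stable (lem P-irr) λ ¬p →
    differ (mk⇔ (λ p → contradiction p ¬p) (λ ¬q → contradiction q ¬q)))

winningI⇒selfcontractible : (funext : Extensionality 0ℓ 0ℓ) (lem : LEM) →
  ∀ {A} σ → Irrelevant A → WinningI A (∁ A) σ →
  BaireSpace.Selfcontractible funext lem A
winningI⇒selfcontractible funext lem σ A-irr win none = none
  ( responseI σ
  , modulus⇒contraction funext lem (responseI-modulus σ)
  , (λ {b} → Equivalence.to (preserves b)) , (λ {b} → Equivalence.from (preserves b)))
  where
  preserves = λ b → ¬⇔¬⇒⇔ lem A-irr A-irr
    (win (responseI σ b) b (responseI-follows σ b))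

selfcontractible⇒nonselfdual :
  (funext : Extensionality 0ℓ 0ℓ) (lem : LEM) → ∀ {A} →
  BaireSpace.Selfcontractible funext lem A → BaireSpace.LNonselfdual funext lem A
selfcontractible⇒nonselfdual funext lem {A} selfcontractible selfdual =
  selfcontractible λ { (f , f-contraction , fx∈A⇒x∈A , x∈A⇒fx∈A) →
  selfdual λ { (g , g-nonexpansive , x∈A⇒gx∉A , gx∉A⇒x∈A) →
    let x , fgx≡x = banach (contraction⇒modulus funext lem f-contraction
                            ∘ nonexpansive⇒modulus funext lem g-nonexpansive) funext
        -- Since `f (g x)` is `x`, the points `g x` and `x` lie on the same side of `A`, while `g`
        -- exchanges the sides.
        x∉A : ¬ A x
        x∉A = λ x∈A → x∈A⇒gx∉A x∈A (fx∈A⇒x∈A (subst A (sym fgx≡x) x∈A))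
    in x∉A (gx∉A⇒x∈A λ gx∈A → x∉A (subst A fgx≡x (x∈A⇒fx∈A gx∈A))) } }

corollary4p4 : (funext : Extensionality 0ℓ 0ℓ) (lem : LEM) → DC-ℝ → AD-L →
    (A : Pred Baire 0ℓ) → Irrelevant A →
    BaireSpace.Selfcontractible funext lem A ⇔ BaireSpace.LNonselfdual funext lem A
corollary4p4 funext lem _ ad A A-irr = mk⇔
  (selfcontractible⇒nonselfdual funext lem)
  -- Assuming `none` leaves an empty goal, so a winning strategy can be taken from the truncated
  -- determinacy.
  (λ nonselfdual none → ad A (∁ A) A-irr (λ x∉A _ → funext λ x∈A → contradiction x∈A x∉A)
    [ (λ { (σ , win) → winningI⇒selfcontractible funext lem σ A-irr win none })
    , (λ { (τ , win) → nonselfdual (winningII⇒≤ᴸ funext lem τ win) }) ]′)
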